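{- Let $p_1=2$, $p_2=5$, $p_3=11$, $p_4=18$, $p_5=21$, $p_6=23$; $\mu_1=1$, $\mu_2=7$, $\mu_3=12$, $\mu_4=18$, $\mu_5=20$, $\mu_6=53979$; and $a_1=4735$, $a_2=2941$, $a_3=514$, $a_4=593$, $a_5=213$, $a_6=391$. Then for every positive integer $q$, the complete multipartite graph $K_{a_1\cdot p_1q,\,a_2\cdot p_2q,\,a_3\cdot p_3q,\,a_4\cdot p_4q,\,a_5\cdot p_5q,\,a_6\cdot p_6q}$ on $qn$ vertices, where $n=\sum_{i=1}^{6}a_ip_i$, is distance integral.
   Context: For a simple connected undirected graph $G$ with vertices $v_1,\dots,v_N$, the distance matrix $D(G)$ is the $N\times N$ matrix whose $(i,j)$-entry is the length $d_{ij}$ of a shortest path between $v_i$ and $v_j$ (so $d_{ii}=0$). $G$ is called distance integral if all eigenvalues of $D(G)$ are integers. For distinct positive integers $p_1<\dots<p_s$ and positive integers $a_1,\dots,a_s$, $K_{a_1\cdot p_1,\dots,a_s\cdot p_s}$ denotes the complete multipartite graph having exactly $a_i$ parts of size $p_i$ for each $i=1,\dots,s$ (two vertices are adjacent if and only if they lie in different parts). It has $\sum_i a_i$ parts and $\sum_i a_ip_i$ vertices. The integers $\mu_i$ are the associated parameters related to $p_i,a_i$ (with $s=6$) by $p_1-2<\mu_1<p_2-2<\mu_2<\cdots<p_s-2<\mu_s$ and $a_k=\frac{\prod_{i=1}^{s}(\mu_i-p_k+2)}{p_k\prod_{i=1,i\ne k}^{s}(p_i-p_k)}$ for $k=1,\dots,s$;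 they do not enter the definition of the graph. -}

module Defs where

open import Level using (0ℓ; _⊔_) renaming (suc to lsuc)
open import Algebra.Apartness.Bundles using (HeytingCommutativeRing; HeytingField)
import Algebra.Definitions.RawMonoid as RawMonoidDefs
open import Algebra.Bundles using (CommutativeRing)
open import Data.Fin.Base using (Fin; zero; suc; splitAt)
open import Data.Integer.Base using (ℤ; +_; -[1+_])
open import Data.List.Base using (List; []; _∷_; [_]; length; concatMap; replicate)
open import Data.List.Relation.Unary.Unique.Propositional using (Unique)
open import Data.Nat.Base using (ℕ; suc; _≤_; _+_; _*_)
open import Data.Nat.ListAction using (sum)
open import Data.Product.Base using (Σ; ∃-syntax; _×_; _,_)
open import Data.Sum.Base using ([_,_]′)
open import Data.Vec.Functional using (Vector)
open import Function.Base using (const; _∘_)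
open import Relation.Binary.Core using (Rel)
open import Relation.Binary.Construct.Closure.ReflexiveTransitive using (Star; ε; _◅_)
open import Relation.Binary.Definitions using (Symmetric)
open import Relation.Binary.PropositionalEquality using (_≡_; _≢_; refl; ≢-sym)
open import Relation.Nullary.Negation using (¬_)

Matrix : ∀ {a} → Set a → ℕ → Set a
Matrix A n = Fin n → Fin n → A

record SimpleGraph : Set₁ where
  field
    order  : ℕ
    Adj    : Rel (Fin order) 0ℓ
    sym    : Symmetric Adj
    irrefl : ∀ {v} → ¬ Adj v v

  Vertex : Set
  Vertex = Fin order

  Walk : Rel Vertex 0ℓ
  Walk = Star Adj

  walkLength : ∀ {u v} → Walk u v → ℕ
  walkLength ε       = 0
  walkLength (_ ◅ w) = suc (walkLength w)

  vertices : ∀ {u v} → Walk u v → List Vertex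
  vertices (ε {u})       = [ u ]
  vertices (_◅_ {u} _ w) = u ∷ vertices w

  IsPath : ∀ {u v} → Walk u v → Set
  IsPath w = Unique (vertices w)

  record IsDistance (u v : Vertex) (d : ℕ) : Set where
    field
      attained : ∃[ w ] IsPath {u} {v} w × walkLength w ≡ d
      shortest : (w : Walk u v) → IsPath w → d ≤ walkLength w

  -- Distances are unique, so a distance matrix is determined up to pointwise
  -- equality; one exists only if the graph is connected.
  IsDistanceMatrix : Matrix ℕ order → Set
  IsDistanceMatrix D = ∀ u v → IsDistance u v (D u v)

module _ {c ℓ₁ ℓ₂} (K : HeytingField c ℓ₁ ℓ₂) where
  open HeytingField K
    using (Carrier; _≈_; _#_; -_; 0#; 1#; heytingCommutativeRing)
    renaming (_*_ to _*ᴷ_)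
  open CommutativeRing
    (HeytingCommutativeRing.commutativeRing heytingCommutativeRing)
    using (+-rawMonoid)
  open RawMonoidDefs +-rawMonoid using () renaming (sum to ∑; _×_ to _×ᴷ_)

  fromℕ : ℕ → Carrier
  fromℕ n = n ×ᴷ 1#

  fromℤ : ℤ → Carrier
  fromℤ (+ n)    = fromℕ n
  fromℤ -[1+ n ] = - fromℕ (suc n)

  CharacteristicZero : Set ℓ₂
  CharacteristicZero = ∀ n → fromℕ (suc n) # 0#

  IsEigenvalue : ∀ {n} → Matrix Carrier n → Carrier → Set (c ⊔ ℓ₁ ⊔ ℓ₂)
  IsEigenvalue {n} A λ′ = Σ (Vector Carrier n) λ x →
    (∃[ i ] x i # 0#) ×
    (∀ i → ∑ (λ j → A i j *ᴷ x j) ≈ λ′ *ᴷ x i)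

-- There is no field of real numbers at hand, so eigenvalues are taken in an
-- arbitrary field of characteristic zero: ℝ and ℂ are instances.  This asks for
-- nothing more than integrality of the complex eigenvalues, since an eigenvalue
-- in any such field is a root of the (integral) characteristic polynomial.
-- The apartness _#_ of a Heyting field is the constructive form of ≠; with
-- excluded middle Heyting fields are exactly fields.
IntegralSpectrum : ∀ c ℓ₁ ℓ₂ {n} → Matrix ℕ n → Set (lsuc (c ⊔ ℓ₁ ⊔ ℓ₂))
IntegralSpectrum c ℓ₁ ℓ₂ A =
  (K : HeytingField c ℓ₁ ℓ₂) → CharacteristicZero K →
  let open HeytingField K using (Carrier; _≈_) in
  (λ′ : Carrier) → IsEigenvalue K (λ i j → fromℕ K (A i j)) λ′ →
  ∃[ z ] λ′ ≈ fromℤ K z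

DistanceIntegral : ∀ c ℓ₁ ℓ₂ → SimpleGraph → Set (lsuc (c ⊔ ℓ₁ ⊔ ℓ₂))
DistanceIntegral c ℓ₁ ℓ₂ G =
  ∃[ D ] SimpleGraph.IsDistanceMatrix G D × IntegralSpectrum c ℓ₁ ℓ₂ D

-- The vertices are numbered part by part: the first p belong to the first
-- part, and so on.
part : (ps : List ℕ) → Fin (sum ps) → Fin (length ps)
part (p ∷ ps) v = [ const zero , suc ∘ part ps ]′ (splitAt p v)

completeMultipartite : List ℕ → SimpleGraph
completeMultipartite ps = record
  { order  = sum ps
  ; Adj    = λ u v → part ps u ≢ part ps v
  ; sym    = ≢-sym
  ; irrefl = λ u≢u → u≢u refl
  }

-- K[ (a₁ , p₁) ∷ … ∷ (aₛ , pₛ) ∷ [] ] has aᵢ parts of size pᵢ.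
K[_] : List (ℕ × ℕ) → SimpleGraph
K[ aps ] = completeMultipartite (concatMap (λ (a , p) → replicate a p) aps)

p₁ p₂ p₃ p₄ p₅ p₆ : ℕ
p₁ = 2
p₂ = 5
p₃ = 11
p₄ = 18
p₅ = 21
p₆ = 23

a₁ a₂ a₃ a₄ a₅ a₆ : ℕ
a₁ = 4735
a₂ = 2941
a₃ = 514
a₄ = 593
a₅ = 213
a₆ = 391

n : ℕ
n = a₁ * p₁ + a₂ * p₂ + a₃ * p₃ + a₄ * p₄ + a₅ * p₅ + a₆ * p₆

K⟨_⟩ : ℕ → SimpleGraph
K⟨ q ⟩ = K[ (a₁ , p₁ * q) ∷ (a₂ , p₂ * q) ∷ (a₃ , p₃ * q) ∷
            (a₄ , p₄ * q) ∷ (a₅ , p₅ * q) ∷ (a₆ , p₆ * q) ∷ [] ]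

{-# OPTIONS --safe #-}

-- Put t = λ + 2.  An eigenvector x with total S satisfies t xᵢ = S + Sₖ, where Sₖ
-- is the sum of x over the part of i.  If t differs from 0 and from every part
-- size, then summing over a part of size P gives Sₖ = P / (t - P) · S, so summing
-- over all parts gives (1 - Σ a P / (t - P)) S = 0.  With w = - q / t the bracket
-- becomes, after clearing denominators, a polynomial in w with natural
-- coefficients, and it factors as ∏ (1 + m w) with m = μ + 2.  Hence, if t also
-- differs from every m q, then S = 0 and x = 0.  So t is 0, some p q or some m q;
-- constructively, t is apart from all but one of these candidates by
-- cotransitivity, and equal to the remaining one by tightness.
module Submission where

open import Defs
open import Algebra.Apartness.Bundles using (HeytingCommutativeRing; HeytingField)
open import Algebra.Bundles using (CommutativeRing)
import Algebra.Apartness.Properties.HeytingCommutativeRing as HeytingProperties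
import Algebra.Properties.CommutativeMonoid.Sum as SumProperties
import Algebra.Properties.Ring as RingProperties
import Algebra.Properties.Semiring.Mult as MultProperties
import Algebra.Properties.Semiring.Sum as SemiringSumProperties
import Algebra.Solver.Ring.NaturalCoefficients.Default as SemiringSolver
open import Data.Bool.Base using (if_then_else_)
open import Data.Fin.Base using (Fin; zero; suc; _↑ˡ_; _↑ʳ_; splitAt)
open import Data.Fin.Properties
  using (_≟_; splitAt-↑ˡ; splitAt-↑ʳ; join-splitAt)
open import Data.Integer.Base using (+_; -[1+_])
open import Data.List.Base
  using (List; []; _∷_; _++_; map; foldr; replicate; concatMap)
open import Data.List.Membership.Propositional using (_∈_)
open import Data.List.Relation.Unary.All as All using (All; []; _∷_)
open import Data.List.Relation.Unary.All.Properties using (map⁻; ++⁻ˡ; ++⁻ʳ)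
open import Data.List.Relation.Unary.AllPairs using ([]; _∷_)
open import Data.List.Relation.Unary.Any using (here; there)
open import Data.List.Relation.Unary.Unique.DecPropositional using (unique?)
open import Data.List.Relation.Unary.Unique.Propositional using (Unique)
open import Data.Nat.Base as ℕ using (ℕ; zero; suc; _+_; _*_; NonZero; z≤n; s≤s)
open import Data.Nat.ListAction using (sum)
import Data.Nat.Properties as ℕ
open import Data.Product.Base using (_×_; _,_; proj₁; proj₂; map₂; ∃-syntax)
open import Data.Sum.Base using (inj₁; inj₂)
open import Data.Vec.Functional using (Vector)
open import Function.Base using (_∘_)
open import Relation.Binary.Construct.Closure.ReflexiveTransitive using (ε; _◅_)
open import Relation.Binary.Definitions using (tri<; tri≈; tri>)
open import Relation.Binary.PropositionalEquality as ≡ using (_≡_; _≢_)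
import Relation.Binary.Reasoning.Setoid as SetoidReasoning
open import Relation.Nullary.Decidable using (does; yes; no; from-yes)
open import Relation.Nullary.Negation using (¬_; contradiction)

-- Distances in a complete multipartite graph.

δ : ∀ {m} → Matrix ℕ m
δ i j = if does (i ≟ j) then 1 else 0

same : (ps : List ℕ) → Matrix ℕ (sum ps)
same ps u v = δ (part ps u) (part ps v)

distance : (ps : List ℕ) → Matrix ℕ (sum ps)
distance ps u v = if does (u ≟ v) then 0 else suc (same ps u v)

δ-refl : ∀ {m} (i : Fin m) → δ i i ≡ 1
δ-refl i with i ≟ i
... | yes _  = ≡.refl
... | no i≢i = contradiction ≡.refl i≢i

-- In matrix form D + 2I = J + B, with J all ones and B the block matrix `same`. This is the source
-- of the shift t = λ + 2.
distance+2δ : ∀ ps u v → distance ps u v + 2 * δ u v ≡ 1 + same ps u v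
distance+2δ ps u v with u ≟ v
... | yes ≡.refl = ≡.cong suc (≡.sym (δ-refl (part ps u)))
... | no _       = ℕ.+-identityʳ _

module _ (p : ℕ) (ps : List ℕ) where

  same-↑ˡ-↑ˡ : ∀ i j → same (p ∷ ps) (i ↑ˡ sum ps) (j ↑ˡ sum ps) ≡ 1
  same-↑ˡ-↑ˡ i j rewrite splitAt-↑ˡ p i (sum ps) | splitAt-↑ˡ p j (sum ps) = ≡.refl

  same-↑ˡ-↑ʳ : ∀ i j → same (p ∷ ps) (i ↑ˡ sum ps) (p ↑ʳ j) ≡ 0
  same-↑ˡ-↑ʳ i j rewrite splitAt-↑ˡ p i (sum ps) | splitAt-↑ʳ p (sum ps) j = ≡.refl

  same-↑ʳ-↑ˡ : ∀ i j → same (p ∷ ps) (p ↑ʳ i) (j ↑ˡ sum ps) ≡ 0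
  same-↑ʳ-↑ˡ i j rewrite splitAt-↑ʳ p (sum ps) i | splitAt-↑ˡ p j (sum ps) = ≡.refl

  same-↑ʳ-↑ʳ : ∀ i j → same (p ∷ ps) (p ↑ʳ i) (p ↑ʳ j) ≡ same ps i j
  same-↑ʳ-↑ʳ i j rewrite splitAt-↑ʳ p (sum ps) i | splitAt-↑ʳ p (sum ps) j = ≡.refl

module _ (ps : List ℕ) where
  open SimpleGraph (completeMultipartite ps)

  -- Non-adjacent vertices lie in one part, so any neighbour of `u` is also adjacent to `v` and
  -- gives a path of length 2.
  distance-isDistanceMatrix : (∀ u → ∃[ w ] Adj u w) → IsDistanceMatrix (distance ps)
  distance-isDistanceMatrix neighbour u v with u ≟ v
  ... | yes ≡.refl = record
    { attained = ε , ([] ∷ []) , ≡.refl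
    ; shortest = λ _ _ → z≤n
    }
  ... | no u≢v with part ps u ≟ part ps v
  ...   | no u~v = record
    { attained = (u~v ◅ ε) , ((u≢v ∷ []) ∷ [] ∷ []) , ≡.refl
    ; shortest = λ { ε _ → contradiction ≡.refl u≢v ; (_ ◅ _) _ → s≤s z≤n }
    }
  ...   | yes u≈v = record
    { attained = (u~w ◅ w~v ◅ ε)
               , (((u~w ∘ ≡.cong (part ps)) ∷ u≢v ∷ [])
                 ∷ ((w~v ∘ ≡.cong (part ps)) ∷ []) ∷ [] ∷ [])
               , ≡.refl
    ; shortest = λ { ε _           → contradiction ≡.refl u≢v
                   ; (e ◅ ε) _     → contradiction u≈v e
                   ; (_ ◅ _ ◅ _) _ → s≤s (s≤s z≤n) }
    }
    where
    w   = proj₁ (neighbour u)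
    u~w = proj₂ (neighbour u)
    w~v : Adj w v
    w~v w≈v = u~w (≡.trans u≈v (≡.sym w≈v))

two-parts⇒neighbour : ∀ a b ps → let ps′ = suc a ∷ suc b ∷ ps in
  (u : Fin (sum ps′)) → ∃[ w ] SimpleGraph.Adj (completeMultipartite ps′) u w
two-parts⇒neighbour a b ps u with part (suc a ∷ suc b ∷ ps) u ≟ zero
... | no u≢0  = zero , u≢0
... | yes u≡0 = suc a ↑ʳ zero , adj
  where
  adj : part (suc a ∷ suc b ∷ ps) u ≢ part (suc a ∷ suc b ∷ ps) (suc a ↑ʳ zero)
  -- The index is `a`, not `suc a`: `splitAt (suc a)` on a successor has already reduced to
  -- `splitAt a`.
  adj rewrite u≡0 | splitAt-↑ʳ a (sum (suc b ∷ ps)) zero = λ ()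

-- Groups of equal parts and the polynomials attached to them.

sizes : List (ℕ × ℕ) → List ℕ
sizes = concatMap (λ (a , p) → replicate a p)

scale : ℕ → List (ℕ × ℕ) → List (ℕ × ℕ)
scale q = map (map₂ (_* q))

total : List (ℕ × ℕ) → ℕ
total []             = 0
total ((a , p) ∷ gs) = a * p + total gs

sum-replicate-++ : ∀ a p ps → sum (replicate a p ++ ps) ≡ a * p + sum ps
sum-replicate-++ zero    p ps = ≡.refl
sum-replicate-++ (suc a) p ps =
  ≡.trans (≡.cong (_+_ p) (sum-replicate-++ a p ps)) (≡.sym (ℕ.+-assoc p (a * p) (sum ps)))

sum-sizes-scale : ∀ q gs → sum (sizes (scale q gs)) ≡ total gs * q
sum-sizes-scale q []             = ≡.refl
sum-sizes-scale q ((a , p) ∷ gs) = begin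
  sum (replicate a (p * q) ++ sizes (scale q gs)) ≡⟨ sum-replicate-++ a (p * q) _ ⟩
  a * (p * q) + sum (sizes (scale q gs))          ≡⟨ ≡.cong₂ _+_ (≡.sym (ℕ.*-assoc a p q)) (sum-sizes-scale q gs) ⟩
  a * p * q + total gs * q                        ≡⟨ ℕ.*-distribʳ-+ q (a * p) (total gs) ⟨
  (a * p + total gs) * q                          ∎
  where open ≡.≡-Reasoning

-- Coefficient lists, constant term first.
Poly : Set
Poly = List ℕ

infixl 6 _⊕_
_⊕_ : Poly → Poly → Poly
[]       ⊕ ds       = ds
(c ∷ cs) ⊕ []       = c ∷ cs
(c ∷ cs) ⊕ (d ∷ ds) = c + d ∷ cs ⊕ ds

infixl 7 _⊛_
_⊛_ : ℕ → Poly → Poly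
k ⊛ cs = map (_*_ k) cs

[1+_X]⊛_ : ℕ → Poly → Poly
[1+ m X]⊛ cs = cs ⊕ (0 ∷ m ⊛ cs)

∏[1+_X] : List ℕ → Poly
∏[1+ ms X] = foldr [1+_X]⊛_ (1 ∷ []) ms

-- numerator gs / denominator gs = Σ a p X / (1 + p X).
denominator : List (ℕ × ℕ) → Poly
denominator gs = ∏[1+ map proj₂ gs X]

numerator : List (ℕ × ℕ) → Poly
numerator []             = []
numerator ((a , p) ∷ gs) = (0 ∷ (a * p) ⊛ denominator gs) ⊕ ([1+ p X]⊛ numerator gs)

-- Arithmetic in a Heyting field.

module FieldLemmas {c ℓ₁ ℓ₂} (K : HeytingField c ℓ₁ ℓ₂) where
  open HeytingField K public
    hiding (zero)
    renaming (_+_ to _+ᴷ_; _*_ to _*ᴷ_; _-_ to _-ᴷ_; -_ to -ᴷ_)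
  open CommutativeRing
    (HeytingCommutativeRing.commutativeRing heytingCommutativeRing) public
    using (ring; semiring; commutativeSemiring; +-commutativeMonoid)
  open HeytingProperties heytingCommutativeRing public
  open RingProperties ring public using (-‿distribˡ-*)
  open MultProperties semiring public using (×-homo-+; ×1-homo-*; ×-assoc-*; ×-congʳ)
    renaming (_×_ to _×ᴷ_)
  open SumProperties +-commutativeMonoid public
    using (sum-cong-≋; ∑-distrib-+; sum-replicate; sum-replicate-zero)
    renaming (sum to ∑)
  open SemiringSumProperties semiring public using (*-distribˡ-sum)
  open SemiringSolver commutativeSemiring public
    using (solve; _:=_; _:+_; _:*_; con)
  open SetoidReasoning setoid public

  ι : ℕ → Carrier
  ι = fromℕ K

  ι-+ : ∀ m k → ι (m + k) ≈ ι m +ᴷ ι k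
  ι-+ = ×-homo-+ 1#

  ι-* : ∀ m k → ι (m * k) ≈ ι m *ᴷ ι k
  ι-* = ×1-homo-*

  ι-1 : ι 1 ≈ 1#
  ι-1 = +-identityʳ 1#

  ×≈ι* : ∀ m x → m ×ᴷ x ≈ ι m *ᴷ x
  ×≈ι* m x = begin
    m ×ᴷ x          ≈⟨ ×-congʳ m (*-identityˡ x) ⟨
    m ×ᴷ (1# *ᴷ x)  ≈⟨ ×-assoc-* m 1# x ⟨
    ι m *ᴷ x        ∎

  #⇒-#0 : ∀ {x y} → x # y → x -ᴷ y # 0#
  #⇒-#0 {x} {y} x#y with #⇒invertible x#y
  ... | z , z*[x-y]≈1 , _ = invertibleˡ⇒# (z , trans (*-congˡ (x-0≈x _)) z*[x-y]≈1)

  inverse : ∀ {x} → x # 0# → ∃[ y ] y *ᴷ x ≈ 1#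
  inverse x#0 with #⇒invertible x#0
  ... | y , y*x≈1 , _ = y , trans (*-congˡ (sym (x-0≈x _))) y*x≈1

  -- If `z` inverts `x y`, then `z x` inverts `y`.
  *-#0ʳ : ∀ {x y} → x *ᴷ y # 0# → y # 0#
  *-#0ʳ {x} {y} xy#0 with inverse xy#0
  ... | z , z*xy≈1 = invertibleˡ⇒#
    (z *ᴷ x , trans (*-congˡ (x-0≈x y)) (trans (*-assoc z x y) z*xy≈1))

  x#0∧xy≈0⇒y≈0 : ∀ {x y} → x # 0# → x *ᴷ y ≈ 0# → y ≈ 0#
  x#0∧xy≈0⇒y≈0 {x} {y} x#0 xy≈0 with inverse x#0
  ... | z , zx≈1 = begin
    y              ≈⟨ *-identityˡ y ⟨
    1# *ᴷ y        ≈⟨ *-congʳ zx≈1 ⟨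
    z *ᴷ x *ᴷ y    ≈⟨ *-assoc z x y ⟩
    z *ᴷ (x *ᴷ y)  ≈⟨ *-congˡ xy≈0 ⟩
    z *ᴷ 0#        ≈⟨ zeroʳ z ⟩
    0#             ∎

  *-cancelˡ-# : ∀ {x} → x # 0# → ∀ {y z} → x *ᴷ y ≈ x *ᴷ z → y ≈ z
  *-cancelˡ-# {x} x#0 {y} {z} xy≈xz with inverse x#0
  ... | x′ , x′x≈1 = begin
    y               ≈⟨ expand y ⟨
    x′ *ᴷ (x *ᴷ y)  ≈⟨ *-congˡ xy≈xz ⟩
    x′ *ᴷ (x *ᴷ z)  ≈⟨ expand z ⟩
    z               ∎
    where
    expand : ∀ u → x′ *ᴷ (x *ᴷ u) ≈ u
    expand u = trans (sym (*-assoc x′ x u)) (trans (*-congʳ x′x≈1) (*-identityˡ u))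

  x+y≈z⇒x≈z-y : ∀ {x y z} → x +ᴷ y ≈ z → x ≈ z -ᴷ y
  x+y≈z⇒x≈z-y {x} {y} {z} x+y≈z = begin
    x                  ≈⟨ +-identityʳ x ⟨
    x +ᴷ 0#            ≈⟨ +-congˡ (-‿inverseʳ y) ⟨
    x +ᴷ (y -ᴷ y)      ≈⟨ +-assoc x y (-ᴷ y) ⟨
    x +ᴷ y -ᴷ y        ≈⟨ +-congʳ x+y≈z ⟩
    z -ᴷ y             ∎

  -- Undoes the shift t = λ + 2. The cases 0 and 1 are separate because k - 2 is negative there: the
  -- integers are -2 and -1.
  x+2≈ι⇒integer : ∀ {x} k → x +ᴷ ι 2 ≈ ι k → ∃[ z ] x ≈ fromℤ K z
  x+2≈ι⇒integer {x} 0 eq = -[1+ 1 ] , trans (x+y≈z⇒x≈z-y eq) (+-identityˡ _)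
  x+2≈ι⇒integer {x} 1 eq = -[1+ 0 ] , trans
    (x+y≈z⇒x≈z-y (+-cancelʳ′ (begin
      x +ᴷ ι 1 +ᴷ 1#  ≈⟨ solve 2 (λ x o → (x :+ (o :+ con 0)) :+ o := x :+ (o :+ (o :+ con 0))) refl x 1# ⟩
      x +ᴷ ι 2        ≈⟨ eq ⟩
      1# +ᴷ 0#        ≈⟨ +-comm 1# 0# ⟩
      0# +ᴷ 1#        ∎)))
    (+-identityˡ _)
    where
    +-cancelʳ′ : ∀ {a b} → a +ᴷ 1# ≈ b +ᴷ 1# → a ≈ b
    +-cancelʳ′ {a} {b} h = trans (x+y≈z⇒x≈z-y h) (sym (x+y≈z⇒x≈z-y refl))
  x+2≈ι⇒integer {x} (suc (suc k)) eq = + k , (begin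
    x                      ≈⟨ x+y≈z⇒x≈z-y eq ⟩
    ι (2 + k) -ᴷ ι 2       ≈⟨ +-congʳ (trans (ι-+ 2 k) (+-comm (ι 2) (ι k))) ⟩
    ι k +ᴷ ι 2 -ᴷ ι 2      ≈⟨ x+y≈z⇒x≈z-y refl ⟨
    ι k                    ∎)

  -- Rows of natural-number matrices applied to vectors.

  row : ∀ {m} → (Fin m → ℕ) → Vector Carrier m → Carrier
  row A x = ∑ (λ j → ι (A j) *ᴷ x j)

  row-cong : ∀ {m} {A B : Fin m → ℕ} x → (∀ j → A j ≡ B j) → row A x ≈ row B x
  row-cong x A≡B = sum-cong-≋ (λ j → *-congʳ (reflexive (≡.cong ι (A≡B j))))

  row-+ : ∀ {m} (A B : Fin m → ℕ) x → row (λ j → A j + B j) x ≈ row A x +ᴷ row B x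
  row-+ A B x = trans
    (sum-cong-≋ (λ j → trans (*-congʳ (ι-+ (A j) (B j))) (distribʳ (x j) (ι (A j)) (ι (B j)))))
    (∑-distrib-+ (λ j → ι (A j) *ᴷ x j) (λ j → ι (B j) *ᴷ x j))

  row-* : ∀ {m} k (A : Fin m → ℕ) x → row (λ j → k * A j) x ≈ ι k *ᴷ row A x
  row-* k A x = trans
    (sum-cong-≋ (λ j → trans (*-congʳ (ι-* k (A j))) (*-assoc (ι k) (ι (A j)) (x j))))
    (sym (*-distribˡ-sum (ι k) (λ j → ι (A j) *ᴷ x j)))

  row-1 : ∀ {m} (x : Vector Carrier m) → row (λ _ → 1) x ≈ ∑ x
  row-1 x = sum-cong-≋ (λ j → trans (*-congʳ ι-1) (*-identityˡ (x j)))

  row-0 : ∀ {m} (x : Vector Carrier m) → row (λ _ → 0) x ≈ 0#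
  row-0 {m} x = trans (sum-cong-≋ (λ j → zeroˡ (x j))) (sum-replicate-zero m)

  row-δ : ∀ {m} (i : Fin m) x → row (δ i) x ≈ x i
  row-δ {suc m} zero x = begin
    ι 1 *ᴷ x zero +ᴷ row {m} (λ _ → 0) (x ∘ suc)  ≈⟨ +-cong (trans (*-congʳ ι-1) (*-identityˡ _)) (row-0 (x ∘ suc)) ⟩
    x zero +ᴷ 0#                                  ≈⟨ +-identityʳ _ ⟩
    x zero                                        ∎
  row-δ (suc i) x = begin
    0# *ᴷ x zero +ᴷ row (δ i) (x ∘ suc)  ≈⟨ +-cong (zeroˡ _) (row-δ i (x ∘ suc)) ⟩
    0# +ᴷ x (suc i)                      ≈⟨ +-identityˡ _ ⟩
    x (suc i)                            ∎

  ∑-splitAt : ∀ m {k} (x : Vector Carrier (m + k)) →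
              ∑ x ≈ ∑ (x ∘ (_↑ˡ k)) +ᴷ ∑ (x ∘ (m ↑ʳ_))
  ∑-splitAt zero    x = sym (+-identityˡ _)
  ∑-splitAt (suc m) x = trans (+-congˡ (∑-splitAt m (x ∘ suc))) (sym (+-assoc _ _ _))

  module _ (p : ℕ) (ps : List ℕ) (x : Vector Carrier (p + sum ps)) where

    row-same-↑ˡ : ∀ i → row (same (p ∷ ps) (i ↑ˡ sum ps)) x ≈ ∑ (x ∘ (_↑ˡ sum ps))
    row-same-↑ˡ i = begin
      row (same (p ∷ ps) (i ↑ˡ sum ps)) x
        ≈⟨ ∑-splitAt p (λ j → ι (same (p ∷ ps) (i ↑ˡ sum ps) j) *ᴷ x j) ⟩
      row (same (p ∷ ps) (i ↑ˡ sum ps) ∘ (_↑ˡ sum ps)) (x ∘ (_↑ˡ sum ps))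
        +ᴷ row (same (p ∷ ps) (i ↑ˡ sum ps) ∘ (p ↑ʳ_)) (x ∘ (p ↑ʳ_))
        ≈⟨ +-cong (trans (row-cong _ (same-↑ˡ-↑ˡ p ps i)) (row-1 (x ∘ (_↑ˡ sum ps))))
                  (trans (row-cong _ (same-↑ˡ-↑ʳ p ps i)) (row-0 (x ∘ (p ↑ʳ_)))) ⟩
      ∑ (x ∘ (_↑ˡ sum ps)) +ᴷ 0#
        ≈⟨ +-identityʳ _ ⟩
      ∑ (x ∘ (_↑ˡ sum ps)) ∎

    row-same-↑ʳ : ∀ i → row (same (p ∷ ps) (p ↑ʳ i)) x ≈ row (same ps i) (x ∘ (p ↑ʳ_))
    row-same-↑ʳ i = begin
      row (same (p ∷ ps) (p ↑ʳ i)) x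
        ≈⟨ ∑-splitAt p (λ j → ι (same (p ∷ ps) (p ↑ʳ i) j) *ᴷ x j) ⟩
      row (same (p ∷ ps) (p ↑ʳ i) ∘ (_↑ˡ sum ps)) (x ∘ (_↑ˡ sum ps))
        +ᴷ row (same (p ∷ ps) (p ↑ʳ i) ∘ (p ↑ʳ_)) (x ∘ (p ↑ʳ_))
        ≈⟨ +-cong (trans (row-cong _ (same-↑ʳ-↑ˡ p ps i)) (row-0 (x ∘ (_↑ˡ sum ps))))
                  (row-cong _ (same-↑ʳ-↑ʳ p ps i)) ⟩
      0# +ᴷ row (same ps i) (x ∘ (p ↑ʳ_))
        ≈⟨ +-identityˡ _ ⟩
      row (same ps i) (x ∘ (p ↑ʳ_)) ∎

  -- Applies D + 2I = J + B to `x`: J contributes the total of `x`, and B the sum over the part of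
  -- `i`.
  eigenvector⇒parts : ∀ ps {λ′} {x : Vector Carrier (sum ps)} →
    (∀ i → row (distance ps i) x ≈ λ′ *ᴷ x i) →
    ∀ i → (λ′ +ᴷ ι 2) *ᴷ x i ≈ ∑ x +ᴷ row (same ps i) x
  eigenvector⇒parts ps {λ′} {x} Dx≈λx i = begin
    (λ′ +ᴷ ι 2) *ᴷ x i                                ≈⟨ distribʳ (x i) λ′ (ι 2) ⟩
    λ′ *ᴷ x i +ᴷ ι 2 *ᴷ x i                           ≈⟨ +-cong (sym (Dx≈λx i)) (*-congˡ (sym (row-δ i x))) ⟩
    row (distance ps i) x +ᴷ ι 2 *ᴷ row (δ i) x       ≈⟨ +-congˡ (row-* 2 (δ i) x) ⟨
    row (distance ps i) x +ᴷ row (λ j → 2 * δ i j) x  ≈⟨ row-+ (distance ps i) (λ j → 2 * δ i j) x ⟨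
    row (λ j → distance ps i j + 2 * δ i j) x         ≈⟨ row-cong x (distance+2δ ps i) ⟩
    row (λ j → 1 + same ps i j) x                     ≈⟨ row-+ (λ _ → 1) (same ps i) x ⟩
    row (λ _ → 1) x +ᴷ row (same ps i) x              ≈⟨ +-congʳ (row-1 x) ⟩
    ∑ x +ᴷ row (same ps i) x                          ∎

  -- Evaluation of polynomials.

  module Evaluation (w : Carrier) where

    eval : Poly → Carrier
    eval []       = 0#
    eval (c ∷ cs) = ι c +ᴷ w *ᴷ eval cs

    eval-⊕ : ∀ cs ds → eval (cs ⊕ ds) ≈ eval cs +ᴷ eval ds
    eval-⊕ []       ds       = sym (+-identityˡ _)
    eval-⊕ (c ∷ cs) []       = sym (+-identityʳ _)
    eval-⊕ (c ∷ cs) (d ∷ ds) = trans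
      (+-cong (ι-+ c d) (*-congˡ (eval-⊕ cs ds)))
      (solve 5 (λ c d w x y → (c :+ d) :+ w :* (x :+ y) := (c :+ w :* x) :+ (d :+ w :* y))
        refl (ι c) (ι d) w (eval cs) (eval ds))

    eval-⊛ : ∀ k cs → eval (k ⊛ cs) ≈ ι k *ᴷ eval cs
    eval-⊛ k []       = sym (zeroʳ _)
    eval-⊛ k (c ∷ cs) = trans
      (+-cong (ι-* k c) (*-congˡ (eval-⊛ k cs)))
      (solve 4 (λ k c w x → k :* c :+ w :* (k :* x) := k :* (c :+ w :* x))
        refl (ι k) (ι c) w (eval cs))

    eval-X⊛ : ∀ k cs → eval (0 ∷ k ⊛ cs) ≈ ι k *ᴷ w *ᴷ eval cs
    eval-X⊛ k cs = trans (+-identityˡ _) (trans (*-congˡ (eval-⊛ k cs))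
      (solve 3 (λ w k x → w :* (k :* x) := k :* w :* x) refl w (ι k) (eval cs)))

    eval-[1+X] : ∀ m cs → eval ([1+ m X]⊛ cs) ≈ (1# +ᴷ ι m *ᴷ w) *ᴷ eval cs
    eval-[1+X] m cs = begin
      eval (cs ⊕ (0 ∷ m ⊛ cs))                  ≈⟨ eval-⊕ cs _ ⟩
      eval cs +ᴷ eval (0 ∷ m ⊛ cs)              ≈⟨ +-cong (sym (*-identityˡ _)) (eval-X⊛ m cs) ⟩
      1# *ᴷ eval cs +ᴷ ι m *ᴷ w *ᴷ eval cs      ≈⟨ distribʳ (eval cs) 1# (ι m *ᴷ w) ⟨
      (1# +ᴷ ι m *ᴷ w) *ᴷ eval cs               ∎

  -- Solving the eigenvector equations part by part.

  module PartSums (t : Carrier) (t#0 : t # 0#) where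

    -- In the equations t xᵢ = S + Sₖ, S is a free parameter rather than the total
    -- of x, so that they can be solved one part at a time.
    Solves : List ℕ → Carrier → Set _
    Solves ps C = ∀ S (x : Vector Carrier (sum ps)) →
      (∀ i → t *ᴷ x i ≈ S +ᴷ row (same ps i) x) →
      ∑ x ≈ C *ᴷ S × (S ≈ 0# → ∀ i → x i ≈ 0#)

    Solves-resp-≈ : ∀ ps {C C′} → C ≈ C′ → Solves ps C → Solves ps C′
    Solves-resp-≈ ps C≈C′ sol S x eqs =
      trans (proj₁ (sol S x eqs)) (*-congʳ C≈C′) , proj₂ (sol S x eqs)

    Solves-[] : Solves [] 0#
    Solves-[] S x eqs = sym (zeroˡ S) , λ _ ()

    -- Here `e` is P / (t - P), given by its defining equation. Summing t yᵢ = S + Y over the new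
    -- part yields (t - P) Y = P S. As `same` vanishes across parts, the remaining entries satisfy
    -- the equations for `ps` with the same `S`.
    Solves-∷ : ∀ p ps {e C} → t # ι p → (t -ᴷ ι p) *ᴷ e ≈ ι p →
               Solves ps C → Solves (p ∷ ps) (e +ᴷ C)
    Solves-∷ p ps {e} {C} t#p [t-p]e≈p sol S x eqs = total≈ , vanishing
      where
      P = ι p
      y = x ∘ (_↑ˡ sum ps)
      z = x ∘ (p ↑ʳ_)
      Y = ∑ y

      eqsʸ : ∀ i → t *ᴷ y i ≈ S +ᴷ Y
      eqsʸ i = trans (eqs (i ↑ˡ sum ps)) (+-congˡ (row-same-↑ˡ p ps x i))

      eqsᶻ : ∀ i → t *ᴷ z i ≈ S +ᴷ row (same ps i) z
      eqsᶻ i = trans (eqs (p ↑ʳ i)) (+-congˡ (row-same-↑ʳ p ps x i))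

      tY≈P[S+Y] : t *ᴷ Y ≈ P *ᴷ (S +ᴷ Y)
      tY≈P[S+Y] = begin
        t *ᴷ Y                ≈⟨ *-distribˡ-sum t y ⟩
        ∑ (λ i → t *ᴷ y i)    ≈⟨ sum-cong-≋ eqsʸ ⟩
        ∑ {p} (λ _ → S +ᴷ Y)  ≈⟨ sum-replicate p ⟩
        p ×ᴷ (S +ᴷ Y)         ≈⟨ ×≈ι* p (S +ᴷ Y) ⟩
        P *ᴷ (S +ᴷ Y)         ∎

      Y≈eS : Y ≈ e *ᴷ S
      Y≈eS = *-cancelˡ-# (#⇒-#0 t#p) (begin
        (t -ᴷ P) *ᴷ Y                       ≈⟨ distribʳ Y t (-ᴷ P) ⟩
        t *ᴷ Y +ᴷ (-ᴷ P) *ᴷ Y               ≈⟨ +-congʳ tY≈P[S+Y] ⟩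
        P *ᴷ (S +ᴷ Y) +ᴷ (-ᴷ P) *ᴷ Y        ≈⟨ solve 4 (λ P N S Y → P :* (S :+ Y) :+ N :* Y := P :* S :+ (P :+ N) :* Y) refl P (-ᴷ P) S Y ⟩
        P *ᴷ S +ᴷ (P -ᴷ P) *ᴷ Y             ≈⟨ +-congˡ (trans (*-congʳ (-‿inverseʳ P)) (zeroˡ Y)) ⟩
        P *ᴷ S +ᴷ 0#                        ≈⟨ +-identityʳ _ ⟩
        P *ᴷ S                              ≈⟨ *-congʳ [t-p]e≈p ⟨
        (t -ᴷ P) *ᴷ e *ᴷ S                  ≈⟨ *-assoc _ e S ⟩
        (t -ᴷ P) *ᴷ (e *ᴷ S)                ∎)

      total≈ : ∑ x ≈ (e +ᴷ C) *ᴷ S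
      total≈ = begin
        ∑ x                    ≈⟨ ∑-splitAt p x ⟩
        Y +ᴷ ∑ z               ≈⟨ +-cong Y≈eS (proj₁ (sol S z eqsᶻ)) ⟩
        e *ᴷ S +ᴷ C *ᴷ S       ≈⟨ distribʳ S e C ⟨
        (e +ᴷ C) *ᴷ S          ∎

      vanishing : S ≈ 0# → ∀ i → x i ≈ 0#
      vanishing S≈0 i with splitAt p i | join-splitAt p (sum ps) i
      ... | inj₂ j | ≡.refl = proj₂ (sol S z eqsᶻ) S≈0 j
      -- With S = 0 also Y = e S = 0, so t yⱼ = 0, and t is invertible.
      ... | inj₁ j | ≡.refl = x#0∧xy≈0⇒y≈0 t#0 (begin
        t *ᴷ y j         ≈⟨ eqsʸ j ⟩
        S +ᴷ Y           ≈⟨ +-cong S≈0 (trans Y≈eS (trans (*-congˡ S≈0) (zeroʳ e))) ⟩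
        0# +ᴷ 0#         ≈⟨ +-identityˡ 0# ⟩
        0#               ∎)

    Solves-replicate : ∀ a p ps {e C} → t # ι p → (t -ᴷ ι p) *ᴷ e ≈ ι p →
                       Solves ps C → Solves (replicate a p ++ ps) (ι a *ᴷ e +ᴷ C)
    Solves-replicate zero    p ps t#p [t-p]e≈p sol =
      Solves-resp-≈ ps (sym (trans (+-congʳ (zeroˡ _)) (+-identityˡ _))) sol
    Solves-replicate (suc a) p ps {e} {C} t#p [t-p]e≈p sol =
      Solves-resp-≈ (replicate (suc a) p ++ ps)
        (trans (sym (+-assoc e (ι a *ᴷ e) C)) (+-congʳ
          (trans (+-congʳ (sym (*-identityˡ e))) (sym (distribʳ e 1# (ι a))))))
        (Solves-∷ p (replicate a p ++ ps) t#p [t-p]e≈p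
          (Solves-replicate a p ps t#p [t-p]e≈p sol))

    -- Clearing denominators by the substitution w = - q / t.

    module Scaled (q : ℕ) where

      -- For this value 1 + m w = (t - m q) / t, so `q` is absorbed into `w` and the polynomials
      -- involve only the unscaled sizes.
      w : Carrier
      w = proj₁ (inverse t#0) *ᴷ (-ᴷ ι q)

      open Evaluation w

      tw≈-q : t *ᴷ w ≈ -ᴷ ι q
      tw≈-q = begin
        t *ᴷ (t⁻¹ *ᴷ (-ᴷ ι q))  ≈⟨ solve 3 (λ t u v → t :* (u :* v) := u :* t :* v) refl t t⁻¹ (-ᴷ ι q) ⟩
        t⁻¹ *ᴷ t *ᴷ (-ᴷ ι q)    ≈⟨ *-congʳ (proj₂ (inverse t#0)) ⟩
        1# *ᴷ (-ᴷ ι q)          ≈⟨ *-identityˡ _ ⟩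
        -ᴷ ι q                  ∎
        where t⁻¹ = proj₁ (inverse t#0)

      t[mw]≈-mq : ∀ m → t *ᴷ (ι m *ᴷ w) ≈ -ᴷ ι (m * q)
      t[mw]≈-mq m = begin
        t *ᴷ (ι m *ᴷ w)     ≈⟨ solve 3 (λ t m w → t :* (m :* w) := t :* w :* m) refl t (ι m) w ⟩
        t *ᴷ w *ᴷ ι m       ≈⟨ *-congʳ tw≈-q ⟩
        (-ᴷ ι q) *ᴷ ι m     ≈⟨ -‿distribˡ-* (ι q) (ι m) ⟨
        -ᴷ (ι q *ᴷ ι m)     ≈⟨ -‿cong (trans (*-comm (ι q) (ι m)) (sym (ι-* m q))) ⟩
        -ᴷ ι (m * q)        ∎

      t[1+mw]≈t-mq : ∀ m → t *ᴷ (1# +ᴷ ι m *ᴷ w) ≈ t -ᴷ ι (m * q)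
      t[1+mw]≈t-mq m = trans (distribˡ t 1# (ι m *ᴷ w)) (+-cong (*-identityʳ t) (t[mw]≈-mq m))

      1+mw#0 : ∀ m → t # ι (m * q) → 1# +ᴷ ι m *ᴷ w # 0#
      1+mw#0 m t#mq = *-#0ʳ (#-congʳ (sym (t[1+mw]≈t-mq m)) (#⇒-#0 t#mq))

      eval-∏#0 : ∀ {ms} → All (λ m → t # ι (m * q)) ms → eval ∏[1+ ms X] # 0#
      eval-∏#0 []                = #-congʳ
        (sym (trans (+-cong ι-1 (zeroʳ w)) (+-identityʳ 1#))) 1#0
      eval-∏#0 {m ∷ ms} (t#m ∷ t#ms) = #-congʳ
        (sym (eval-[1+X] m ∏[1+ ms X])) (x#0y#0→xy#0 (1+mw#0 m t#m) (eval-∏#0 t#ms))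

      -- For P = p q, P / (t - P) = - p w / (1 + p w), so C = Σ a P / (t - P) is minus numerator
      -- over denominator at `w`. Multiplying out leaves an identity without division or
      -- subtraction.
      Solves-sizes : ∀ gs → All (λ (_ , p) → t # ι (p * q)) gs →
        ∃[ C ] Solves (sizes (scale q gs)) C ×
               eval (denominator gs) *ᴷ C +ᴷ eval (numerator gs) ≈ 0#
      Solves-sizes [] [] = 0# , Solves-[] , trans (+-identityʳ _) (zeroʳ _)
      Solves-sizes ((a , p) ∷ gs) (t#pq ∷ t#gs)
        with C , sol , identity ← Solves-sizes gs t#gs
        with d , d[t-pq]≈1 ← inverse (#⇒-#0 t#pq)
        = ι a *ᴷ e +ᴷ C
        , Solves-replicate a (p * q) (sizes (scale q gs)) t#pq [t-pq]e≈pq sol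
        , identity′
        where
        e = d *ᴷ ι (p * q)
        b = 1# +ᴷ ι p *ᴷ w
        G = eval (denominator gs)
        N = eval (numerator gs)

        [t-pq]e≈pq : (t -ᴷ ι (p * q)) *ᴷ e ≈ ι (p * q)
        [t-pq]e≈pq = begin
          (t -ᴷ ι (p * q)) *ᴷ (d *ᴷ ι (p * q))  ≈⟨ solve 3 (λ x d P → x :* (d :* P) := d :* x :* P) refl (t -ᴷ ι (p * q)) d (ι (p * q)) ⟩
          d *ᴷ (t -ᴷ ι (p * q)) *ᴷ ι (p * q)    ≈⟨ *-congʳ d[t-pq]≈1 ⟩
          1# *ᴷ ι (p * q)                       ≈⟨ *-identityˡ _ ⟩
          ι (p * q)                             ∎

        -- This says e = - p w / b. It is checked after multiplication by t, where t b = t - p q and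
        -- t p w = - p q.
        be+pw≈0 : b *ᴷ e +ᴷ ι p *ᴷ w ≈ 0#
        be+pw≈0 = x#0∧xy≈0⇒y≈0 t#0 (begin
          t *ᴷ (b *ᴷ e +ᴷ ι p *ᴷ w)               ≈⟨ solve 4 (λ t b e x → t :* (b :* e :+ x) := t :* b :* e :+ t :* x) refl t b e (ι p *ᴷ w) ⟩
          t *ᴷ b *ᴷ e +ᴷ t *ᴷ (ι p *ᴷ w)          ≈⟨ +-cong (*-congʳ (t[1+mw]≈t-mq p)) (t[mw]≈-mq p) ⟩
          (t -ᴷ ι (p * q)) *ᴷ e -ᴷ ι (p * q)      ≈⟨ +-congʳ [t-pq]e≈pq ⟩
          ι (p * q) -ᴷ ι (p * q)                  ≈⟨ -‿inverseʳ _ ⟩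
          0#                                      ∎)

        eval-numerator : eval (numerator ((a , p) ∷ gs)) ≈ ι a *ᴷ ι p *ᴷ w *ᴷ G +ᴷ b *ᴷ N
        eval-numerator = begin
          eval ((0 ∷ (a * p) ⊛ denominator gs) ⊕ ([1+ p X]⊛ numerator gs))
            ≈⟨ eval-⊕ (0 ∷ (a * p) ⊛ denominator gs) ([1+ p X]⊛ numerator gs) ⟩
          eval (0 ∷ (a * p) ⊛ denominator gs) +ᴷ eval ([1+ p X]⊛ numerator gs)
            ≈⟨ +-cong (eval-X⊛ (a * p) (denominator gs)) (eval-[1+X] p (numerator gs)) ⟩
          ι (a * p) *ᴷ w *ᴷ G +ᴷ b *ᴷ N
            ≈⟨ +-congʳ (*-congʳ (*-congʳ (ι-* a p))) ⟩
          ι a *ᴷ ι p *ᴷ w *ᴷ G +ᴷ b *ᴷ N ∎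

        identity′ : eval (denominator ((a , p) ∷ gs)) *ᴷ (ι a *ᴷ e +ᴷ C)
                      +ᴷ eval (numerator ((a , p) ∷ gs)) ≈ 0#
        identity′ = begin
          eval ([1+ p X]⊛ denominator gs) *ᴷ (ι a *ᴷ e +ᴷ C) +ᴷ eval (numerator ((a , p) ∷ gs))
            ≈⟨ +-cong (*-congʳ (eval-[1+X] p (denominator gs))) eval-numerator ⟩
          b *ᴷ G *ᴷ (ι a *ᴷ e +ᴷ C) +ᴷ (ι a *ᴷ ι p *ᴷ w *ᴷ G +ᴷ b *ᴷ N)
            -- The regrouping isolates two factors that vanish: one by `be+pw≈0`, the other by the
            -- identity for the remaining groups.
            ≈⟨ solve 8 (λ b G a e C p w N →
                 b :* G :* (a :* e :+ C) :+ (a :* p :* w :* G :+ b :* N)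
                 := a :* G :* (b :* e :+ p :* w) :+ b :* (G :* C :+ N))
               refl b G (ι a) e C (ι p) w N ⟩
          ι a *ᴷ G *ᴷ (b *ᴷ e +ᴷ ι p *ᴷ w) +ᴷ b *ᴷ (G *ᴷ C +ᴷ N)
            ≈⟨ +-cong (trans (*-congˡ be+pw≈0) (zeroʳ _)) (trans (*-congˡ identity) (zeroʳ b)) ⟩
          0# +ᴷ 0#
            ≈⟨ +-identityˡ 0# ⟩
          0# ∎

      -- The free parameter `S` now becomes the total of `x`, so S = C S. From G C + N = 0 follows
      -- (G + N) S = 0, and G + N is the product of the 1 + m w, which is apart from 0. Hence S = 0,
      -- and then x = 0.
      eigenvector≈0 : ∀ gs ms → denominator gs ⊕ numerator gs ≡ ∏[1+ ms X] →
        All (λ p → t # ι (p * q)) (map proj₂ gs) → All (λ m → t # ι (m * q)) ms →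
        (x : Vector Carrier (sum (sizes (scale q gs)))) →
        (∀ i → t *ᴷ x i ≈ ∑ x +ᴷ row (same (sizes (scale q gs)) i) x) →
        ∀ i → x i ≈ 0#
      eigenvector≈0 gs ms factorisation t#gs t#ms x eqs
        with C , sol , identity ← Solves-sizes gs (map⁻ t#gs)
        = proj₂ (sol S x eqs) (x#0∧xy≈0⇒y≈0 (eval-∏#0 t#ms) (begin
          eval ∏[1+ ms X] *ᴷ S                             ≈⟨ *-congʳ (reflexive (≡.cong eval factorisation)) ⟨
          eval (denominator gs ⊕ numerator gs) *ᴷ S        ≈⟨ *-congʳ (eval-⊕ (denominator gs) (numerator gs)) ⟩
          (G +ᴷ N) *ᴷ S                                    ≈⟨ distribʳ S G N ⟩
          G *ᴷ S +ᴷ N *ᴷ S                                 ≈⟨ +-congʳ (*-congˡ (proj₁ (sol S x eqs))) ⟩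
          G *ᴷ (C *ᴷ S) +ᴷ N *ᴷ S                          ≈⟨ solve 4 (λ G C S N → G :* (C :* S) :+ N :* S := (G :* C :+ N) :* S) refl G C S N ⟩
          (G *ᴷ C +ᴷ N) *ᴷ S                               ≈⟨ *-congʳ identity ⟩
          0# *ᴷ S                                          ≈⟨ zeroˡ S ⟩
          0#                                               ∎))
        where
        S = ∑ x
        G = eval (denominator gs)
        N = eval (numerator gs)

  -- Locating t among finitely many pairwise apart candidates.

  module Candidates (char0 : CharacteristicZero K) (q : ℕ) .{{_ : NonZero q}} where

    ι-<⇒# : ∀ {m k} → m ℕ.< k → ι k # ι m
    -- `char0` speaks of successors, so k - m is written as `suc (k ∸ suc m)`.
    ι-<⇒# {m} {k} m<k with #⇒invertible (char0 (k ℕ.∸ suc m))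
    ... | z , z*d≈1 , _ = invertibleˡ⇒# (z , trans (*-congˡ difference) z*d≈1)
      where
      d = suc (k ℕ.∸ suc m)

      d+m≡k : d + m ≡ k
      d+m≡k = ≡.trans (≡.sym (ℕ.+-suc (k ℕ.∸ suc m) m)) (ℕ.m∸n+n≡m m<k)

      difference : ι k -ᴷ ι m ≈ ι d -ᴷ 0#
      difference = begin
        ι k -ᴷ ι m  ≈⟨ x+y≈z⇒x≈z-y (trans (sym (ι-+ d m)) (reflexive (≡.cong ι d+m≡k))) ⟨
        ι d         ≈⟨ x-0≈x (ι d) ⟨
        ι d -ᴷ 0#   ∎

    ι-≢⇒# : ∀ {m k} → m ≢ k → ι (m * q) # ι (k * q)
    ι-≢⇒# {m} {k} m≢k with ℕ.<-cmp m k
    ... | tri< m<k _ _ = #-sym (ι-<⇒# (ℕ.*-monoˡ-< q m<k))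
    ... | tri≈ _ m≡k _ = contradiction m≡k m≢k
    ... | tri> _ _ k<m = ι-<⇒# (ℕ.*-monoˡ-< q k<m)

    -- Induction keeps one undecided candidate `k`. Cotransitivity between the new head and `k`
    -- shows t apart from one of the two, and the other stays undecided. Membership of `k` is
    -- recorded so that uniqueness separates it from the head.
    critical : ∀ t m ms → Unique (m ∷ ms) → ∃[ k ] k ∈ m ∷ ms ×
      (t # ι (k * q) → All (λ m → t # ι (m * q)) (m ∷ ms))
    critical t m []        _ = m , here ≡.refl , λ t#m → t#m ∷ []
    critical t m (m′ ∷ ms) (m∉ ∷ unique) with critical t m′ ms unique
    ... | k , k∈ , f with #-cotrans (ι-≢⇒# (All.lookup m∉ k∈)) t
    ...   | inj₁ m#t = k , there k∈ , λ t#k → #-sym m#t ∷ f t#k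
    ...   | inj₂ t#k = m , here ≡.refl , λ t#m → t#m ∷ f t#k

    ¬all#⇒≈ : ∀ t m ms → Unique (m ∷ ms) → ¬ All (λ m → t # ι (m * q)) (m ∷ ms) →
              ∃[ k ] t ≈ ι (k * q)
    ¬all#⇒≈ t m ms unique ¬all# with critical t m ms unique
    ... | k , _ , f = k , proj₁ (tight t (ι (k * q))) (¬all# ∘ f)

-- From the factorisation to distance integrality.

-- The list with no repetitions holds all candidates for t / q. If t were apart from every multiple,
-- the eigenvector would vanish, against its nonzero entry; so t = k q for some `k` in ℕ.
distance-integralSpectrum : ∀ {c ℓ₁ ℓ₂} q .{{_ : NonZero q}} gs ms →
  Unique (0 ∷ map proj₂ gs ++ ms) →
  denominator gs ⊕ numerator gs ≡ ∏[1+ ms X] →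
  IntegralSpectrum c ℓ₁ ℓ₂ (distance (sizes (scale q gs)))
distance-integralSpectrum q gs ms unique factorisation K char0 λ′ (x , (i , xᵢ#0) , Dx≈λx) =
  let k , t≈k = ¬all#⇒≈ t 0 (map proj₂ gs ++ ms) unique ¬all#
  in  x+2≈ι⇒integer (k * q) t≈k
  where
  open FieldLemmas K
  open Candidates char0 q

  t = λ′ +ᴷ ι 2

  ¬all# : ¬ All (λ m → t # ι (m * q)) (0 ∷ map proj₂ gs ++ ms)
  ¬all# (t#0 ∷ t#) = proj₂ (tight (x i) 0#)
    (eigenvector≈0 gs ms factorisation (++⁻ˡ (map proj₂ gs) t#) (++⁻ʳ (map proj₂ gs) t#)
      x (eigenvector⇒parts (sizes (scale q gs)) Dx≈λx) i)
    xᵢ#0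
    where
    open PartSums t t#0
    open Scaled q

-- The shape demanded of the first group exhibits two nonempty parts, which gives every vertex a
-- neighbour.
K[scale]-distanceIntegral : ∀ {c ℓ₁ ℓ₂} q .{{_ : NonZero q}} gs ms {a p gs′} →
  gs ≡ (2 + a , suc p) ∷ gs′ →
  Unique (0 ∷ map proj₂ gs ++ ms) →
  denominator gs ⊕ numerator gs ≡ ∏[1+ ms X] →
  DistanceIntegral c ℓ₁ ℓ₂ K[ scale q gs ]
K[scale]-distanceIntegral q@(suc q′) gs ms {a} {p} {gs′} ≡.refl unique factorisation =
    distance (sizes (scale q gs))
  , distance-isDistanceMatrix (sizes (scale q gs))
      -- `suc p * suc q′` computes to `suc (q′ + p * q)`, the successor form of the two leading
      -- sizes.
      (two-parts⇒neighbour (q′ + p * q) (q′ + p * q) (sizes ((a , suc p * q) ∷ scale q gs′)))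
  , distance-integralSpectrum q gs ms unique factorisation

-- The concrete parameters.

groups : List (ℕ × ℕ)
groups = (a₁ , p₁) ∷ (a₂ , p₂) ∷ (a₃ , p₃) ∷ (a₄ , p₄) ∷ (a₅ , p₅) ∷ (a₆ , p₆) ∷ []

-- The numbers μᵢ + 2.
roots : List ℕ
roots = 3 ∷ 9 ∷ 14 ∷ 20 ∷ 22 ∷ 53981 ∷ []

-- Equality of the lists is checked before they are expanded by K[_]: a bare refl
-- would compare the thousands of parts one by one.
K⟨_⟩≡K[scale] : ∀ q → K⟨ q ⟩ ≡ K[ scale q groups ]
K⟨ q ⟩≡K[scale] = ≡.cong K[_]
  {(a₁ , p₁ * q) ∷ (a₂ , p₂ * q) ∷ (a₃ , p₃ * q) ∷
   (a₄ , p₄ * q) ∷ (a₅ , p₅ * q) ∷ (a₆ , p₆ * q) ∷ []}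
  {scale q groups} ≡.refl

theorem9 : ∀ {c ℓ₁ ℓ₂} (q : ℕ) .{{_ : NonZero q}} →
    SimpleGraph.order K⟨ q ⟩ ≡ q * n × DistanceIntegral c ℓ₁ ℓ₂ K⟨ q ⟩
theorem9 {c} {ℓ₁} {ℓ₂} q =
  ≡.subst (λ G → SimpleGraph.order G ≡ q * n × DistanceIntegral c ℓ₁ ℓ₂ G)
    (≡.sym K⟨ q ⟩≡K[scale])
    ( ≡.trans (sum-sizes-scale q groups) (ℕ.*-comm n q)
    -- This `refl` reads off the shape of the first group; the final one compares the seven
    -- coefficients on each side of the factorisation. At X = -1/pₖ that factorisation is the
    -- formula expressing aₖ through the μᵢ.
    , K[scale]-distanceIntegral q groups roots ≡.refl
        (from-yes (unique? ℕ._≟_ (0 ∷ map proj₂ groups ++ roots))) ≡.refl)
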